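{- Let $P=(G,R)$ be a partial field, $n\in\mathbb{N}$, $N=2^n-1$. For an arbitrary point $p=(p_J)_{J\subseteq[n]}\in\mathbf{P}^N(P)$ the following are equivalent: \begin{enumerate} \item There exist a skew-symmetric $n\times n$ matrix $A$ with entries in $P$ and a subset $T\subseteq[n]$ such that (for a suitable representative of $p$) $p_J=\mathrm{Pf}(A_{J\Delta T})$ for all $J\subseteq[n]$. \item $p$ is a strong orthogonal matroid over $P$. \item $p$ is a weak orthogonal matroid over $P$. \end{enumerate}
   Context: A partial field $P=(G,R)$ consists of a commutative ring $R$ with $1$ and a subgroup $G$ of its unit group containing $-1$; elements of $P$ are those of $G\cup\{0\}$; $\mathbf{P}^N(P)$ is the set of nonzero vectors $(p_J)_{J\subseteq[n]}$ with entries in $G\cup\{0\}$ modulo scaling by $G$; all equations are interpreted in $R$. $\Delta$ denotes symmetric difference. For $J\subseteq[n]$, $A_J$ is the principal submatrix with rows and columns $J$ (increasing order). Pfaffian: empty matrix has $\mathrm{Pf}=1$; odd size gives $0$; $\mathrm{Pf}\begin{pmatrix}0&a\\-a&0\end{pmatrix}=a$; for even size $m\ge4$, $\mathrm{Pf}(A)=\sum_{j=2}^m(-1)^j\mathrm{Pf}(A_{\{1,j\}})\mathrm{Pf}(A_{\{2,\dots,m\}\setminus\{j\}})$. Wick equations: $\sum_{j=1}^{k}(-1)^jX_{J_1\Delta\{i_j\}}X_{J_2\Delta\{i_j\}}=0$ for all $J_1,J_2\subseteq[n]$ with $J_1\Delta J_2=\{i_1<\dots<i_k\}$; the $4$-term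 Wick equations are those with $k=4$. A strong orthogonal matroid over $P$ is a point of $\mathbf{P}^N(P)$ satisfying all Wick equations; a weak orthogonal matroid over $P$ is a point of $\mathbf{P}^N(P)$ satisfying the $4$-term Wick equations whose support $\{J: p_J\ne0\}$ is the set of bases of an orthogonal matroid. An orthogonal matroid on $E$ is a nonempty collection $\mathcal{B}$ of subsets of $E$ such that for all $B_1,B_2\in\mathcal{B}$ and $x_1\in B_1\Delta B_2$ there is $x_2\in B_1\Delta B_2$, $x_2\ne x_1$, with $B_1\Delta\{x_1,x_2\}\in\mathcal{B}$. -}

module Defs where

open import Level using (Level; _⊔_)
open import Algebra.Bundles using (CommutativeRing)
open import Data.Bool using (Bool; true; false; not; _xor_)
open import Data.Nat using (ℕ; zero; suc)
open import Data.Fin using (Fin)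
open import Data.Fin as Fin using ()
open import Data.Vec using (Vec; []; _∷_; zipWith; _[_]%=_)
open import Data.Fin.Subset using (Subset; _∈_)
open import Data.List as List using (List; []; _∷_; length)
open import Data.Product using (Σ; ∃; ∃-syntax; _×_; _,_)
open import Data.Sum using (_⊎_)
open import Relation.Nullary using (¬_)
open import Relation.Binary.PropositionalEquality using (_≡_)

record PartialField (c ℓ g : Level) : Set (Level.suc (c ⊔ ℓ ⊔ g)) where
  field
    R : CommutativeRing c ℓ
  open CommutativeRing R public
  field
    G        : Carrier → Set g
    G-resp   : ∀ {x y} → x ≈ y → G x → G y
    G-unit   : ∀ {x} → G x → ∃[ y ] (x * y ≈ 1#)
    G-one    : G 1#
    G-mul    : ∀ {x y} → G x → G y → G (x * y)
    G-inv    : ∀ {x y} → G x → x * y ≈ 1# → G y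
    G-negOne : G (- 1#)

  InP : Carrier → Set (ℓ ⊔ g)
  InP x = G x ⊎ x ≈ 0#

_Δ_ : ∀ {n} → Subset n → Subset n → Subset n
J Δ K = zipWith _xor_ J K

flipAt : ∀ {n} → Subset n → Fin n → Subset n
flipAt J i = J [ i ]%= not

elems : ∀ {n} → Subset n → List (Fin n)
elems []          = []
elems (true ∷ v)  = Fin.zero ∷ List.map Fin.suc (elems v)
elems (false ∷ v) = List.map Fin.suc (elems v)

module _ {c ℓ g} (P : PartialField c ℓ g) where
  open PartialField P

  sgn : ℕ → Carrier
  sgn zero    = 1#
  sgn (suc k) = - sgn k

  sumL : List Carrier → Carrier
  sumL = List.foldr _+_ 0#

  private
    index : ∀ {a} {A : Set a} → ℕ → List A → List (ℕ × A)
    index k []       = []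
    index k (x ∷ xs) = (k , x) ∷ index (suc k) xs

    -- remove the element at position k (1-based)
    removeAt : ∀ {a} {A : Set a} → ℕ → List A → List A
    removeAt k       []       = []
    removeAt zero    (x ∷ xs) = x ∷ xs
    removeAt (suc zero) (x ∷ xs) = xs
    removeAt (suc (suc k)) (x ∷ xs) = x ∷ removeAt (suc k) xs

    even : ℕ → Bool
    even zero    = true
    even (suc k) = not (even k)

    -- recursive expansion with fuel (fuel = size of the matrix)
    -- Pf(A) = Σ_{j=2}^m (-1)^j Pf(A_{1,j}) Pf(A_{[2..m] ∖ {j}}),
    -- with Pf of the 2×2 block (0 a ; -a 0) equal to a and Pf of the
    -- empty matrix equal to 1.
    pfFuel : ∀ {n} → (Fin n → Fin n → Carrier) → ℕ → List (Fin n) → Carrier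
    pfFuel A zero    _        = 1#
    pfFuel A (suc f) []       = 1#
    pfFuel A (suc f) (i ∷ js) =
      sumL (List.map (λ { (k , j) → sgn (suc k) * (A i j * pfFuel A f (removeAt k js)) })
                     (index 1 js))

  -- Pfaffian of the principal submatrix of A with rows/columns the
  -- (increasing) list of indices; zero when that size is odd.
  PfList : ∀ {n} → (Fin n → Fin n → Carrier) → List (Fin n) → Carrier
  PfList A is with even (length is)
  ... | true  = pfFuel A (length is) is
  ... | false = 0#

  PfSub : ∀ {n} → (Fin n → Fin n → Carrier) → Subset n → Carrier
  PfSub A J = PfList A (elems J)

  -- Points of P^N(P): a representative vector (p_J)_{J ⊆ [n]}

  IsPointRep : ∀ {n} → (Subset n → Carrier) → Set (ℓ ⊔ g)
  IsPointRep p = (∀ J → InP (p J)) × (∃[ J ] ¬ (p J ≈ 0#))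

  SkewP : ∀ {n} → (Fin n → Fin n → Carrier) → Set (ℓ ⊔ g)
  SkewP A = (∀ i j → InP (A i j)) × (∀ i j → A j i ≈ - A i j) × (∀ i → A i i ≈ 0#)

  PfaffianRep : ∀ {n} → (Subset n → Carrier) → Set (c ⊔ ℓ ⊔ g)
  PfaffianRep {n} p =
    ∃[ A ] SkewP A × ∃[ T ] ∃[ u ] (G u × (∀ J → u * p J ≈ PfSub A (J Δ T)))

  wickSum : ∀ {n} → (Subset n → Carrier) → Subset n → Subset n → Carrier
  wickSum p J₁ J₂ =
    sumL (List.map (λ { (j , i) → sgn j * (p (flipAt J₁ i) * p (flipAt J₂ i)) })
                   (index 1 (elems (J₁ Δ J₂))))

  AllWick : ∀ {n} → (Subset n → Carrier) → Set ℓ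
  AllWick p = ∀ J₁ J₂ → wickSum p J₁ J₂ ≈ 0#

  FourTermWick : ∀ {n} → (Subset n → Carrier) → Set ℓ
  FourTermWick p = ∀ J₁ J₂ → length (elems (J₁ Δ J₂)) ≡ 4 → wickSum p J₁ J₂ ≈ 0#

  IsOrthogonalMatroid : ∀ {n} {b} → (Subset n → Set b) → Set b
  IsOrthogonalMatroid {n} Bs =
    (∃[ B ] Bs B) ×
    (∀ B₁ B₂ → Bs B₁ → Bs B₂ → ∀ x₁ → x₁ ∈ (B₁ Δ B₂) →
       ∃[ x₂ ] (x₂ ∈ (B₁ Δ B₂) × ¬ (x₂ ≡ x₁) × Bs (flipAt (flipAt B₁ x₁) x₂)))

  support : ∀ {n} → (Subset n → Carrier) → Subset n → Set ℓ
  support p J = ¬ (p J ≈ 0#)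

  StrongOM : ∀ {n} → (Subset n → Carrier) → Set (ℓ ⊔ g)
  StrongOM p = IsPointRep p × AllWick p

  WeakOM : ∀ {n} → (Subset n → Carrier) → Set (ℓ ⊔ g)
  WeakOM p = IsPointRep p × FourTermWick p × IsOrthogonalMatroid (support p)

{-# OPTIONS --safe #-}
-- Regard functions on subsets as elements of the exterior algebra, with f(J) the coefficient
-- of e^J. Expansion of the Pfaffian vector of a skew matrix A along its first row says
-- pf A (1 ∪ J) = (A₁ ∧ pf A')(J) for the remaining matrix A'. The Clifford relations between
-- exterior multiplications and interior products ι_i then give expansion along every row:
-- A_i ∧ pf A = ι_i (pf A). Rewriting every interior product in the Wick sum in this way turns it
-- into Σ_ij (a_ij + a_ji)(…), which vanishes by skewness.
--
-- For strong ⇒ weak, the Wick relation for B₁ Δ {x}, B₂ Δ {x} contains the unit p_B₁ p_B₂, hence a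
-- second nonzero term. For weak ⇒ Pfaffian, normalise q_J = p_(J Δ T) / p_T at a basis T and let A
-- consist of the q_{i,j}. By induction on |J|, q_J = pf A J: if q_(J∖{x,y}) ≠ 0 for some y, exchange
-- towards ∅ yields q_(J∖{x,y,z,w}) ≠ 0, and the 4-term relation with leading term
-- q_J q_(J∖{x,y,z,w}) determines q_J; otherwise q_J = 0 by exchange and pf A J = 0 by expansion
-- along row x.
module Submission where

open import Defs
open import Level using (Level)
open import Algebra.Bundles using (CommutativeRing; CommutativeMonoid)
import Algebra.Properties.Ring as RingProperties
import Algebra.Properties.CommutativeSemigroup as CommutativeSemigroupProperties
open import Data.Nat using (ℕ; zero; suc; _≤_; _<_; s≤s)
import Data.Nat.Properties as ℕ
open import Data.Bool using (Bool; true; false; not; _xor_; if_then_else_)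
open import Data.Bool.Properties using (not-involutive; not-distribˡ-xor; not-distribʳ-xor; xor-same)
open import Data.Fin using (Fin; zero; suc)
import Data.Fin.Properties as Fin
open import Data.Fin.Subset using (Subset; _∈_; _∉_; ∣_∣; ⊥)
open import Data.Fin.Subset.Properties using (∉⊥; ∣⊥∣≡0; _∈?_; nonempty?)
open import Data.List as List using (List; []; _∷_; _++_; length)
import Data.List.Properties as List
open import Data.Product using (_×_; _,_; proj₁; proj₂; ∃-syntax)
open import Data.Sum using (_⊎_; inj₁; inj₂; [_,_]′)
open import Data.Vec using ([]; _∷_; _[_]=_; here; there)
import Data.Vec.Properties as Vec
open import Function using (_∘_; id; flip)
open import Function.Bundles using (_⇔_; mk⇔)
open import Relation.Nullary using (¬_; Dec; yes; no; ¬?; _×-dec_; contradiction; decidable-stable)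
open import Relation.Binary.PropositionalEquality as ≡
  using (_≡_; _≢_; refl; cong; cong₂; subst)

private variable
  n : ℕ

-- Subsets under symmetric difference and flips of single elements.

flipAt-involutive : (J : Subset n) (i : Fin n) → flipAt (flipAt J i) i ≡ J
flipAt-involutive J i = ≡.trans (Vec.updateAt-updateAt i J) (Vec.updateAt-id-local i J (not-involutive _))

flipAt-comm : (J : Subset n) (i j : Fin n) → flipAt (flipAt J i) j ≡ flipAt (flipAt J j) i
flipAt-comm J i j with i Fin.≟ j
... | yes refl = refl
... | no i≢j   = Vec.updateAt-commutes j i (i≢j ∘ ≡.sym) J

flipAt-Δˡ : (J K : Subset n) (i : Fin n) → flipAt J i Δ K ≡ flipAt (J Δ K) i
flipAt-Δˡ (a ∷ J) (b ∷ K) zero    = cong (_∷ (J Δ K)) (≡.sym (not-distribˡ-xor a b))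
flipAt-Δˡ (a ∷ J) (b ∷ K) (suc i) = cong (_ ∷_) (flipAt-Δˡ J K i)

flipAt-Δʳ : (J K : Subset n) (i : Fin n) → J Δ flipAt K i ≡ flipAt (J Δ K) i
flipAt-Δʳ (a ∷ J) (b ∷ K) zero    = cong (_∷ (J Δ K)) (≡.sym (not-distribʳ-xor a b))
flipAt-Δʳ (a ∷ J) (b ∷ K) (suc i) = cong (_ ∷_) (flipAt-Δʳ J K i)

flipAt²-Δ : (J K : Subset n) (i j : Fin n) →
            flipAt (flipAt J i) j Δ K ≡ flipAt (flipAt (J Δ K) i) j
flipAt²-Δ J K i j = ≡.trans (flipAt-Δˡ _ K j) (cong (λ L → flipAt L j) (flipAt-Δˡ J K i))

Δ-self : (J : Subset n) → J Δ J ≡ ⊥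
Δ-self []      = refl
Δ-self (a ∷ J) = cong₂ _∷_ (xor-same a) (Δ-self J)

Δ-cancelʳ : (J T : Subset n) → (J Δ T) Δ T ≡ J
Δ-cancelʳ []      []      = refl
Δ-cancelʳ (a ∷ J) (t ∷ T) = cong₂ _∷_ (xor-cancelʳ a t) (Δ-cancelʳ J T)
  where
  xor-cancelʳ : ∀ a t → (a xor t) xor t ≡ a
  xor-cancelʳ true  true  = refl
  xor-cancelʳ true  false = refl
  xor-cancelʳ false true  = refl
  xor-cancelʳ false false = refl

Δ-translate : (J K T : Subset n) → (J Δ T) Δ (K Δ T) ≡ J Δ K
Δ-translate []      []      []      = refl
Δ-translate (a ∷ J) (b ∷ K) (t ∷ T) = cong₂ _∷_ (xor-translate a b t) (Δ-translate J K T)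
  where
  xor-translate : ∀ a b t → (a xor t) xor (b xor t) ≡ a xor b
  xor-translate true  true  t = xor-same (not t)
  xor-translate true  false true  = refl
  xor-translate true  false false = refl
  xor-translate false true  true  = refl
  xor-translate false true  false = refl
  xor-translate false false t = xor-same t

∉⇒∈flipAt : {J : Subset n} {i : Fin n} → i ∉ J → i ∈ flipAt J i
∉⇒∈flipAt {J = true  ∷ J} {zero}  i∉J = contradiction here i∉J
∉⇒∈flipAt {J = false ∷ J} {zero}  i∉J = here
∉⇒∈flipAt {J = a ∷ J}     {suc i} i∉J = there (∉⇒∈flipAt (i∉J ∘ there))

∈⇒∉flipAt : {J : Subset n} {i : Fin n} → i ∈ J → i ∉ flipAt J i
∈⇒∉flipAt {i = zero}  here      ()
∈⇒∉flipAt {i = suc i} (there p) (there q) = ∈⇒∉flipAt p q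

∈-flipAt⁺ : {J : Subset n} {i j : Fin n} → i ≢ j → i ∈ J → i ∈ flipAt J j
∈-flipAt⁺ {J = J} {i} {j} i≢j = Vec.updateAt-minimal i j J i≢j

∈-flipAt⁻ : {J : Subset n} {i j : Fin n} → i ∈ flipAt J j → i ≡ j ⊎ i ∈ J
∈-flipAt⁻ {J = J} {i} {j} i∈ with i Fin.≟ j
... | yes i≡j = inj₁ i≡j
... | no i≢j  = inj₂ (subst (i ∈_) (flipAt-involutive J j) (∈-flipAt⁺ i≢j i∈))

∈-delete⁻ : {J : Subset n} {i j : Fin n} → j ∈ J → i ∈ flipAt J j → i ≢ j × i ∈ J
∈-delete⁻ j∈J i∈ with ∈-flipAt⁻ i∈
... | inj₁ refl = contradiction i∈ (∈⇒∉flipAt j∈J)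
... | inj₂ i∈J  = (λ { refl → ∈⇒∉flipAt j∈J i∈ }) , i∈J

∣delete∣ : {J : Subset n} {i : Fin n} → i ∈ J → ∣ J ∣ ≡ suc ∣ flipAt J i ∣
∣delete∣ here = refl
∣delete∣ {J = true  ∷ J} (there p) = cong suc (∣delete∣ p)
∣delete∣ {J = false ∷ J} (there p) = ∣delete∣ p

∣adjoin∣ : {J : Subset n} {i : Fin n} → i ∉ J → ∣ flipAt J i ∣ ≡ suc ∣ J ∣
∣adjoin∣ {J = J} {i} i∉J =
  ≡.trans (∣delete∣ (∉⇒∈flipAt i∉J)) (cong (suc ∘ ∣_∣) (flipAt-involutive J i))

∣flipAt∣≤ : (J : Subset n) (i : Fin n) → ∣ flipAt J i ∣ ≤ suc ∣ J ∣
∣flipAt∣≤ J i with i ∈? J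
... | yes i∈J = ℕ.≤-trans (ℕ.≤-trans (ℕ.n≤1+n _) (ℕ.≤-reflexive (≡.sym (∣delete∣ i∈J)))) (ℕ.n≤1+n _)
... | no i∉J  = ℕ.≤-reflexive (∣adjoin∣ i∉J)

∣J∣≡0⇒J≡⊥ : (J : Subset n) → ∣ J ∣ ≡ 0 → J ≡ ⊥
∣J∣≡0⇒J≡⊥ []          _  = refl
∣J∣≡0⇒J≡⊥ (false ∷ J) eq = cong (false ∷_) (∣J∣≡0⇒J≡⊥ J eq)

∣J∣>0⇒nonempty : (J : Subset n) → 0 < ∣ J ∣ → ∃[ i ] i ∈ J
∣J∣>0⇒nonempty (true  ∷ J) _  = zero , here
∣J∣>0⇒nonempty (false ∷ J) lt with ∣J∣>0⇒nonempty J lt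
... | i , i∈J = suc i , there i∈J

length-elems : (J : Subset n) → length (elems J) ≡ ∣ J ∣
length-elems []          = refl
length-elems (true ∷ J)  = cong suc (≡.trans (List.length-map suc (elems J)) (length-elems J))
length-elems (false ∷ J) = ≡.trans (List.length-map suc (elems J)) (length-elems J)

-- Accessible counterpart of the private parity test in the definition of the Pfaffian;
-- `pfWhen-even` identifies the two.
even : ℕ → Bool
even zero    = true
even (suc k) = not (even k)

-- Exterior algebra over a commutative ring: alternating sums and Clifford relations.

module _ {c ℓ} (R : CommutativeRing c ℓ) where
  open CommutativeRing R hiding (refl; sym; trans; zero)
  open CommutativeRing R using () renaming (refl to ≈-refl; sym to ≈-sym; trans to ≈-trans)
  open RingProperties ring
  open CommutativeSemigroupProperties (CommutativeMonoid.commutativeSemigroup +-commutativeMonoid)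
    using (interchange; x∙yz≈y∙xz)
  open CommutativeSemigroupProperties *-commutativeSemigroup
    using () renaming (x∙yz≈y∙xz to x*yz≈y*xz; interchange to *-interchange)
  open import Relation.Binary.Reasoning.Setoid setoid

  private
    -‿cong₂ : ∀ {a a′ b b′} → a ≈ a′ → b ≈ b′ → a - b ≈ a′ - b′
    -‿cong₂ a≈a′ b≈b′ = +-cong a≈a′ (-‿cong b≈b′)

    x-0≈x : ∀ x → x - 0# ≈ x
    x-0≈x x = ≈-trans (+-congˡ -0#≈0#) (+-identityʳ x)

    x-[x-y]≈y : ∀ x y → x - (x - y) ≈ y
    x-[x-y]≈y x y = begin
      x - (x - y)   ≈⟨ +-congˡ (⁻¹-anti-homo‿- x y) ⟩
      x + (y - x)   ≈⟨ +-assoc x y (- x) ⟨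
      (x + y) - x   ≈⟨ xyx⁻¹≈y x y ⟩
      y             ∎

    x≈-y⇒-swap : ∀ {x y} a b → x ≈ - y → a - (b - x) ≈ - (b - (a - y))
    x≈-y⇒-swap {x} {y} a b x≈-y = begin
      a - (b - x)     ≈⟨ +-congˡ (⁻¹-anti-homo‿- b x) ⟩
      a + (x - b)     ≈⟨ +-assoc a x (- b) ⟨
      (a + x) - b     ≈⟨ +-congʳ (+-congˡ x≈-y) ⟩
      (a - y) - b     ≈⟨ ⁻¹-anti-homo‿- b (a - y) ⟨
      - (b - (a - y)) ∎

    -a--[a-b]≈-b : ∀ a b → - a - - (a - b) ≈ - b
    -a--[a-b]≈-b a b = begin
      - a - - (a - b)   ≈⟨ +-congˡ (-‿involutive (a - b)) ⟩
      - a + (a - b)     ≈⟨ +-assoc (- a) a (- b) ⟨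
      (- a + a) - b     ≈⟨ +-congʳ (-‿inverseˡ a) ⟩
      0# - b            ≈⟨ +-identityˡ (- b) ⟩
      - b               ∎

    -‿cancelˡ : ∀ {a a′ b b′} → a ≈ a′ → a - b ≈ a′ - b′ → b ≈ b′
    -‿cancelˡ {a} {a′} {b} {b′} a≈a′ eq = begin
      b             ≈⟨ x-[x-y]≈y a b ⟨
      a - (a - b)   ≈⟨ -‿cong₂ a≈a′ eq ⟩
      a′ - (a′ - b′) ≈⟨ x-[x-y]≈y a′ b′ ⟩
      b′            ∎

    -‿cancelʳ : ∀ {a a′ b b′} → b ≈ b′ → a - b ≈ a′ - b′ → a ≈ a′
    -‿cancelʳ {a} {a′} {b} {b′} b≈b′ eq = begin
      a             ≈⟨ //-rightDividesˡ b a ⟨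
      (a - b) + b   ≈⟨ +-cong eq b≈b′ ⟩
      (a′ - b′) + b′ ≈⟨ //-rightDividesˡ b′ a′ ⟩
      a′            ∎

  -- Signs alternate along the increasing enumeration of S, starting with +.
  altSum : Subset n → (Fin n → Carrier) → Carrier
  altSum []          t = 0#
  altSum (true ∷ S)  t = t zero - altSum S (t ∘ suc)
  altSum (false ∷ S) t = altSum S (t ∘ suc)

  altSum-cong : (S : Subset n) {t u : Fin n → Carrier} →
                (∀ i → i ∈ S → t i ≈ u i) → altSum S t ≈ altSum S u
  altSum-cong []          eq = ≈-refl
  altSum-cong (true ∷ S)  eq = -‿cong₂ (eq zero here) (altSum-cong S (λ i i∈S → eq (suc i) (there i∈S)))
  altSum-cong (false ∷ S) eq = altSum-cong S (λ i i∈S → eq (suc i) (there i∈S))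

  altSum-0 : (S : Subset n) {t : Fin n → Carrier} → (∀ i → i ∈ S → t i ≈ 0#) → altSum S t ≈ 0#
  altSum-0 []          eq = ≈-refl
  altSum-0 (true ∷ S)  eq = ≈-trans (-‿cong₂ (eq zero here) (altSum-0 S (λ i i∈S → eq (suc i) (there i∈S)))) (x-0≈x 0#)
  altSum-0 (false ∷ S) eq = altSum-0 S (λ i i∈S → eq (suc i) (there i∈S))

  altSum-*ˡ : (S : Subset n) (x : Carrier) (t : Fin n → Carrier) →
              altSum S (λ i → x * t i) ≈ x * altSum S t
  altSum-*ˡ []          x t = ≈-sym (zeroʳ x)
  altSum-*ˡ (true ∷ S)  x t = ≈-trans (-‿cong₂ ≈-refl (altSum-*ˡ S x (t ∘ suc))) (≈-sym (x[y-z]≈xy-xz x _ _))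
  altSum-*ˡ (false ∷ S) x t = altSum-*ˡ S x (t ∘ suc)

  altSum-sub : (S : Subset n) (t u : Fin n → Carrier) →
               altSum S (λ i → t i - u i) ≈ altSum S t - altSum S u
  altSum-sub []          t u = ≈-sym (x-0≈x 0#)
  altSum-sub (false ∷ S) t u = altSum-sub S (t ∘ suc) (u ∘ suc)
  altSum-sub (true ∷ S)  t u = begin
    (t zero - u zero) - altSum S (λ i → t (suc i) - u (suc i))
      ≈⟨ +-congˡ (-‿cong (altSum-sub S (t ∘ suc) (u ∘ suc))) ⟩
    (t zero - u zero) - (a - b)     ≈⟨ +-congˡ (-‿+-comm a (- b)) ⟨
    (t zero - u zero) + (- a - - b) ≈⟨ interchange (t zero) (- u zero) (- a) (- - b) ⟩
    (t zero - a) + (- u zero - - b) ≈⟨ +-congˡ (-‿+-comm (u zero) (- b)) ⟩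
    (t zero - a) - (u zero - b)     ∎
    where
    a = altSum S (t ∘ suc)
    b = altSum S (u ∘ suc)

  altSum-neg : (S : Subset n) (t : Fin n → Carrier) → altSum S (λ i → - t i) ≈ - altSum S t
  altSum-neg S t = begin
    altSum S (λ i → - t i)        ≈⟨ altSum-cong S (λ i _ → ≈-sym (-1*x≈-x (t i))) ⟩
    altSum S (λ i → - 1# * t i)   ≈⟨ altSum-*ˡ S (- 1#) t ⟩
    - 1# * altSum S t             ≈⟨ -1*x≈-x _ ⟩
    - altSum S t                  ∎

  altSum-swap : ∀ {m} (S : Subset m) (S′ : Subset n) (t : Fin m → Fin n → Carrier) →
                altSum S (λ i → altSum S′ (t i)) ≈ altSum S′ (λ j → altSum S (λ i → t i j))
  altSum-swap []          S′ t = ≈-sym (altSum-0 S′ (λ _ _ → ≈-refl))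
  altSum-swap (false ∷ S) S′ t = altSum-swap S S′ (t ∘ suc)
  altSum-swap (true ∷ S)  S′ t =
    ≈-trans (+-congˡ (-‿cong (altSum-swap S S′ (t ∘ suc)))) (≈-sym (altSum-sub S′ (t zero) _))

  -- Both sums run over the same `S`, so each index carries the same sign on both sides. Additive
  -- cancellation removes the agreeing terms, and the sign at `x` never has to be computed.
  altSum-isolate : (S : Subset n) {t u : Fin n → Carrier} {x : Fin n} → x ∈ S →
                   (∀ i → i ∈ S → i ≢ x → t i ≈ u i) → altSum S t ≈ altSum S u → t x ≈ u x
  altSum-isolate (true ∷ S) here eq sum≈ =
    -‿cancelʳ (altSum-cong S (λ i i∈S → eq (suc i) (there i∈S) λ ())) sum≈
  altSum-isolate (true ∷ S) (there x∈S) eq sum≈ =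
    altSum-isolate S x∈S (λ i i∈S i≢x → eq (suc i) (there i∈S) (i≢x ∘ Fin.suc-injective))
                         (-‿cancelˡ (eq zero here λ ()) sum≈)
  altSum-isolate (false ∷ S) (there x∈S) eq sum≈ =
    altSum-isolate S x∈S (λ i i∈S i≢x → eq (suc i) (there i∈S) (i≢x ∘ Fin.suc-injective)) sum≈

  -- Exterior multiplication by Σ v_i e^i and, below, the interior product with the i-th dual vector.
  wedge : (Fin n → Carrier) → (Subset n → Carrier) → Subset n → Carrier
  wedge v f J = altSum J (λ i → v i * f (flipAt J i))

  interior : Fin n → (Subset n → Carrier) → Subset n → Carrier
  interior zero    f (false ∷ J) = f (true ∷ J)
  interior zero    f (true ∷ J)  = 0#
  interior (suc i) f (false ∷ J) = interior i (f ∘ (false ∷_)) J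
  interior (suc i) f (true ∷ J)  = - interior i (f ∘ (true ∷_)) J

  wedge-congᶜ : {v w : Fin n → Carrier} (f : Subset n → Carrier) (J : Subset n) →
                   (∀ i → v i ≈ w i) → wedge v f J ≈ wedge w f J
  wedge-congᶜ f J v≈w = altSum-cong J (λ i _ → *-congʳ (v≈w i))

  wedge-cong : (v : Fin n → Carrier) {f g : Subset n → Carrier} (J : Subset n) →
                  (∀ i → i ∈ J → f (flipAt J i) ≈ g (flipAt J i)) → wedge v f J ≈ wedge v g J
  wedge-cong v J f≈g = altSum-cong J (λ i i∈J → *-congˡ (f≈g i i∈J))

  wedge-0 : (v : Fin n → Carrier) {f : Subset n → Carrier} (J : Subset n) →
               (∀ i → i ∈ J → f (flipAt J i) ≈ 0#) → wedge v f J ≈ 0#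
  wedge-0 v J f≈0 = altSum-0 J (λ i i∈J → ≈-trans (*-congˡ (f≈0 i i∈J)) (zeroʳ (v i)))

  wedge-neg : (v : Fin n → Carrier) (f : Subset n → Carrier) (J : Subset n) →
                 wedge v (λ K → - f K) J ≈ - wedge v f J
  wedge-neg v f J = ≈-trans (altSum-cong J (λ i _ → ≈-sym (-‿distribʳ-* (v i) _))) (altSum-neg J _)

  wedge-negᶜ : (v : Fin n → Carrier) (f : Subset n → Carrier) (J : Subset n) →
                  wedge (λ i → - v i) f J ≈ - wedge v f J
  wedge-negᶜ v f J = ≈-trans (altSum-cong J (λ i _ → ≈-sym (-‿distribˡ-* (v i) _))) (altSum-neg J _)

  -- The combination `x * f K - g K` is the shape of `wedge` on `true ∷ K`, so this opens nested
  -- wedges in the inductions on subsets.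
  wedge-lin : (v : Fin n → Carrier) (x : Carrier) (f g : Subset n → Carrier) (J : Subset n) →
                 wedge v (λ K → x * f K - g K) J ≈ x * wedge v f J - wedge v g J
  wedge-lin v x f g J = begin
    altSum J (λ i → v i * (x * f (flipAt J i) - g (flipAt J i)))
      ≈⟨ altSum-cong J (λ i _ → ≈-trans (x[y-z]≈xy-xz _ _ _) (+-congʳ (x*yz≈y*xz _ _ _))) ⟩
    altSum J (λ i → x * (v i * f (flipAt J i)) - v i * g (flipAt J i))
      ≈⟨ altSum-sub J _ _ ⟩
    altSum J (λ i → x * (v i * f (flipAt J i))) - wedge v g J
      ≈⟨ +-congʳ (altSum-*ˡ J x _) ⟩
    x * wedge v f J - wedge v g J ∎

  interior-lin : (i : Fin n) (x : Carrier) (f g : Subset n → Carrier) (J : Subset n) →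
               interior i (λ K → x * f K - g K) J ≈ x * interior i f J - interior i g J
  interior-lin zero    x f g (false ∷ J) = ≈-refl
  interior-lin zero    x f g (true ∷ J)  = ≈-sym (≈-trans (x-0≈x _) (zeroʳ x))
  interior-lin (suc i) x f g (false ∷ J) = interior-lin i x _ _ J
  interior-lin (suc i) x f g (true ∷ J)  = begin
    - interior i (λ K → x * f (true ∷ K) - g (true ∷ K)) J ≈⟨ -‿cong (interior-lin i x _ _ J) ⟩
    - (x * a - b)     ≈⟨ -‿+-comm _ _ ⟨
    - (x * a) - - b   ≈⟨ +-congʳ (-‿distribʳ-* x a) ⟩
    x * - a - - b     ∎
    where
    a = interior i (f ∘ (true ∷_)) J
    b = interior i (g ∘ (true ∷_)) J

  -- Proved by its own induction: anticommutation with `w = v` would only show that twice the value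
  -- vanishes, which says nothing in characteristic 2.
  wedge² : (v : Fin n → Carrier) (f : Subset n → Carrier) (J : Subset n) →
              wedge v (wedge v f) J ≈ 0#
  wedge² v f []          = ≈-refl
  wedge² v f (false ∷ J) = wedge² (v ∘ suc) (f ∘ (false ∷_)) J
  wedge² v f (true ∷ J)  = begin
    a - wedge v′ (λ K → v zero * f₀ K - wedge v′ f₁ K) J
      ≈⟨ +-congˡ (-‿cong (wedge-lin v′ (v zero) f₀ (wedge v′ f₁) J)) ⟩
    a - (a - wedge v′ (wedge v′ f₁) J) ≈⟨ x-[x-y]≈y a _ ⟩
    wedge v′ (wedge v′ f₁) J           ≈⟨ wedge² v′ f₁ J ⟩
    0#                                       ∎
    where
    v′ = v ∘ suc
    f₀ = f ∘ (false ∷_)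
    f₁ = f ∘ (true ∷_)
    a  = v zero * wedge v′ f₀ J

  wedge-anticomm : (v w : Fin n → Carrier) (f : Subset n → Carrier) (J : Subset n) →
                      wedge v (wedge w f) J ≈ - wedge w (wedge v f) J
  wedge-anticomm v w f []          = ≈-sym -0#≈0#
  wedge-anticomm v w f (false ∷ J) = wedge-anticomm (v ∘ suc) (w ∘ suc) (f ∘ (false ∷_)) J
  wedge-anticomm v w f (true ∷ J)  = begin
    a - wedge v′ (λ K → w zero * f₀ K - wedge w′ f₁ K) J
      ≈⟨ +-congˡ (-‿cong (wedge-lin v′ (w zero) f₀ (wedge w′ f₁) J)) ⟩
    a - (b - wedge v′ (wedge w′ f₁) J)
      ≈⟨ x≈-y⇒-swap a b (wedge-anticomm v′ w′ f₁ J) ⟩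
    - (b - (a - wedge w′ (wedge v′ f₁) J))
      ≈⟨ -‿cong (+-congˡ (-‿cong (wedge-lin w′ (v zero) f₀ (wedge v′ f₁) J))) ⟨
    - (b - wedge w′ (λ K → v zero * f₀ K - wedge v′ f₁ K) J) ∎
    where
    v′ = v ∘ suc
    w′ = w ∘ suc
    f₀ = f ∘ (false ∷_)
    f₁ = f ∘ (true ∷_)
    a  = v zero * wedge w′ f₀ J
    b  = w zero * wedge v′ f₀ J

  -- The Clifford relation `v ∧ ι_i f + ι_i (v ∧ f) = v_i f`, that is, the interior product is an
  -- antiderivation.
  wedge-interior : (v : Fin n → Carrier) (i : Fin n) (f : Subset n → Carrier) (J : Subset n) →
                    wedge v (interior i f) J ≈ v i * f J - interior i (wedge v f) J
  wedge-interior v zero f (false ∷ J) = ≈-sym (x-[x-y]≈y _ _)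
  wedge-interior v zero f (true ∷ J)  = -‿cong₂ ≈-refl (wedge-0 (v ∘ suc) J (λ _ _ → ≈-refl))
  wedge-interior v (suc i) f (false ∷ J) = wedge-interior (v ∘ suc) i (f ∘ (false ∷_)) J
  wedge-interior v (suc i) f (true ∷ J)  = begin
    b - wedge v′ (λ K → - interior i f₁ K) J
      ≈⟨ +-congˡ (-‿cong (wedge-neg v′ (interior i f₁) J)) ⟩
    b - - wedge v′ (interior i f₁) J
      ≈⟨ +-congˡ (-‿involutive _) ⟩
    b + wedge v′ (interior i f₁) J
      ≈⟨ +-congˡ (wedge-interior v′ i f₁ J) ⟩
    b + (a - z)
      ≈⟨ x∙yz≈y∙xz b a (- z) ⟩
    a + (b - z)
      ≈⟨ +-congˡ (-‿involutive (b - z)) ⟨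
    a - - (b - z)
      ≈⟨ +-congˡ (-‿cong (-‿cong (interior-lin i (v zero) f₀ _ J))) ⟨
    a - - interior i (λ K → v zero * f₀ K - wedge v′ f₁ K) J ∎
    where
    v′ = v ∘ suc
    f₀ = f ∘ (false ∷_)
    f₁ = f ∘ (true ∷_)
    a  = v (suc i) * f₁ J
    b  = v zero * interior i f₀ J
    z  = interior i (wedge v′ f₁) J

  -- For `x` in `J`, the interior product at `J` without `x` is `f J` up to a sign, and vanishing is
  -- insensitive to signs.
  interior-delete-0 : (f : Subset n → Carrier) {J : Subset n} {x : Fin n} → x ∈ J →
                    interior x f (flipAt J x) ≈ 0# → f J ≈ 0#
  interior-delete-0 f {x = zero} here ins≈0 = ins≈0
  interior-delete-0 f {J = false ∷ J} (there x∈J) ins≈0 = interior-delete-0 (f ∘ (false ∷_)) x∈J ins≈0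
  interior-delete-0 f {J = true ∷ J}  (there x∈J) ins≈0 = interior-delete-0 (f ∘ (true ∷_)) x∈J
    (-‿injective (≈-trans ins≈0 (≈-sym -0#≈0#)))

  -- Wick sums through exterior and interior products.

  wick : (p q : Subset n → Carrier) → Subset n → Subset n → Carrier
  wick p q J K = altSum (J Δ K) (λ i → p (flipAt J i) * q (flipAt K i))

  -- The sign of `i` in `J Δ K` is the product of its signs relative to `J` and to `K`, since common
  -- elements count twice. `wedge` supplies one sign and `interior` the other; as `interior i`
  -- vanishes on sets containing `i`, the two summands collect `i` in `J` only and `i` in `K` only.
  -- `p` and `q` are kept independent because the induction restricts them to different halves of
  -- the subsets.
  wick-wedge : (p q : Subset n → Carrier) (J K : Subset n) →
                  wick p q J K ≈ wedge (λ i → interior i q K) p J + wedge (λ i → interior i p J) q K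
  wick-wedge p q [] [] = ≈-sym (+-identityʳ 0#)
  wick-wedge p q (false ∷ J) (false ∷ K) = wick-wedge (p ∘ (false ∷_)) (q ∘ (false ∷_)) J K
  wick-wedge p q (true ∷ J)  (true ∷ K)  =
    ≈-trans (wick-wedge (p ∘ (true ∷_)) (q ∘ (true ∷_)) J K)
            (+-cong (step (λ i → interior i (q ∘ (true ∷_)) K) (p ∘ (false ∷_)) (p ∘ (true ∷_)) J)
                    (step (λ i → interior i (p ∘ (true ∷_)) J) (q ∘ (false ∷_)) (q ∘ (true ∷_)) K))
    where
    -- A common first element contributes zero, and the sign of `interior` in passing it cancels the
    -- sign of the alternating sum.
    step : (w : Fin n → Carrier) (f₀ f₁ : Subset n → Carrier) (L : Subset n) →
           wedge w f₁ L ≈ 0# * f₀ L - wedge (λ i → - w i) f₁ L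
    step w f₀ f₁ L = ≈-sym (begin
      0# * f₀ L - wedge (λ i → - w i) f₁ L ≈⟨ -‿cong₂ (zeroˡ _) (wedge-negᶜ w f₁ L) ⟩
      0# - - wedge w f₁ L                  ≈⟨ +-identityˡ _ ⟩
      - - wedge w f₁ L                     ≈⟨ -‿involutive _ ⟩
      wedge w f₁ L                         ∎)
  wick-wedge p q (false ∷ J) (true ∷ K)  = begin
    a - wick (p ∘ (false ∷_)) (q ∘ (true ∷_)) J K
      ≈⟨ +-congˡ (-‿cong (wick-wedge (p ∘ (false ∷_)) (q ∘ (true ∷_)) J K)) ⟩
    a - (x + y)     ≈⟨ +-congˡ (-‿+-comm x y) ⟨
    a + (- x - y)   ≈⟨ x∙yz≈y∙xz a (- x) (- y) ⟩
    - x + (a - y)   ≈⟨ +-congʳ (wedge-negᶜ _ (p ∘ (false ∷_)) J) ⟨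
    wedge (λ i → - interior i (q ∘ (true ∷_)) K) (p ∘ (false ∷_)) J + (a - y) ∎
    where
    a = p (true ∷ J) * q (false ∷ K)
    x = wedge (λ i → interior i (q ∘ (true ∷_)) K) (p ∘ (false ∷_)) J
    y = wedge (λ i → interior i (p ∘ (false ∷_)) J) (q ∘ (true ∷_)) K
  wick-wedge p q (true ∷ J)  (false ∷ K) = begin
    a - wick (p ∘ (true ∷_)) (q ∘ (false ∷_)) J K
      ≈⟨ +-congˡ (-‿cong (wick-wedge (p ∘ (true ∷_)) (q ∘ (false ∷_)) J K)) ⟩
    a - (x + y)     ≈⟨ +-congˡ (-‿+-comm x y) ⟨
    a + (- x - y)   ≈⟨ +-assoc a (- x) (- y) ⟨
    (a - x) - y     ≈⟨ +-cong (+-congʳ (*-comm _ _)) (≈-sym (wedge-negᶜ _ (q ∘ (false ∷_)) K)) ⟩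
    (q (true ∷ K) * p (false ∷ J) - x) + wedge (λ i → - interior i (p ∘ (true ∷_)) J) (q ∘ (false ∷_)) K ∎
    where
    a = p (false ∷ J) * q (true ∷ K)
    x = wedge (λ i → interior i (q ∘ (false ∷_)) K) (p ∘ (true ∷_)) J
    y = wedge (λ i → interior i (p ∘ (true ∷_)) J) (q ∘ (false ∷_)) K

  wedge-swap : ∀ {m} (B : Fin m → Fin n → Carrier) (p : Subset m → Carrier) (q : Subset n → Carrier)
                  (J : Subset m) (K : Subset n) →
                  wedge (λ i → wedge (B i) q K) p J ≈ wedge (λ j → wedge (flip B j) p J) q K
  wedge-swap B p q J K = begin
    altSum J (λ i → wedge (B i) q K * p (flipAt J i))
      ≈⟨ altSum-cong J (λ i _ → ≈-trans (*-comm _ _) (≈-sym (altSum-*ˡ K _ _))) ⟩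
    altSum J (λ i → altSum K (λ j → p (flipAt J i) * (B i j * q (flipAt K j))))
      ≈⟨ altSum-swap J K _ ⟩
    altSum K (λ j → altSum J (λ i → p (flipAt J i) * (B i j * q (flipAt K j))))
      ≈⟨ altSum-cong K (λ j _ → altSum-cong J (λ i _ → ≈-trans (≈-sym (*-assoc _ _ _)) (≈-trans (*-comm _ _) (*-congˡ (*-comm _ _))))) ⟩
    altSum K (λ j → altSum J (λ i → q (flipAt K j) * (B i j * p (flipAt J i))))
      ≈⟨ altSum-cong K (λ j _ → ≈-trans (altSum-*ˡ J _ _) (*-comm _ _)) ⟩
    altSum K (λ j → wedge (flip B j) p J * q (flipAt K j)) ∎

  -- Pfaffians: row expansion, Wick relations and the matrix of pairs.

  pf : (Fin n → Fin n → Carrier) → Subset n → Carrier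
  pf A []          = 1#
  pf A (false ∷ J) = pf (λ i j → A (suc i) (suc j)) J
  pf A (true ∷ J)  = wedge (A zero ∘ suc) (pf (λ i j → A (suc i) (suc j))) J

  Skew : (Fin n → Fin n → Carrier) → Set ℓ
  Skew A = (∀ i j → A j i ≈ - A i j) × (∀ i → A i i ≈ 0#)

  -- Along the first row this is the definition of `pf`, or `v ∧ v = 0` together with the zero
  -- diagonal. For a later row, `A_i` is moved past the first row by anticommutation and replaced by
  -- `ι_i` inductively; the Clifford relation then brings `ι_i` outside, and its extra term cancels
  -- the entry in the first column by skewness.
  pf-expand : (A : Fin n → Fin n → Carrier) → Skew A → ∀ i J →
              wedge (A i) (pf A) J ≈ interior i (pf A) J
  pf-expand A (anti , diag) zero (false ∷ J) = ≈-refl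
  pf-expand A (anti , diag) zero (true ∷ J)  = begin
    A zero zero * pf A (false ∷ J) - wedge v (wedge v (pf A′)) J
      ≈⟨ -‿cong₂ (≈-trans (*-congʳ (diag zero)) (zeroˡ _)) (wedge² v (pf A′) J) ⟩
    0# - 0#  ≈⟨ x-0≈x 0# ⟩
    0#       ∎
    where
    A′ = λ i j → A (suc i) (suc j)
    v  = A zero ∘ suc
  pf-expand A (anti , diag) (suc i) (false ∷ J) =
    pf-expand (λ i j → A (suc i) (suc j)) ((λ i j → anti (suc i) (suc j)) , diag ∘ suc) i J
  pf-expand A (anti , diag) (suc i) (true ∷ J)  = begin
    A (suc i) zero * pf A′ J - wedge w (wedge v (pf A′)) J
      ≈⟨ -‿cong₂ (≈-trans (*-congʳ (anti zero (suc i))) (≈-sym (-‿distribˡ-* _ _))) (wedge-anticomm w v (pf A′) J) ⟩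
    - a - - wedge v (wedge w (pf A′)) J
      ≈⟨ +-congˡ (-‿cong (-‿cong (wedge-cong v {wedge w (pf A′)} {interior i (pf A′)} J (λ k _ → ih (flipAt J k))))) ⟩
    - a - - wedge v (interior i (pf A′)) J
      ≈⟨ +-congˡ (-‿cong (-‿cong (wedge-interior v i (pf A′) J))) ⟩
    - a - - (a - interior i (wedge v (pf A′)) J)
      ≈⟨ -a--[a-b]≈-b a _ ⟩
    - interior i (wedge v (pf A′)) J ∎
    where
    A′ = λ i j → A (suc i) (suc j)
    v  = A zero ∘ suc
    w  = A (suc i) ∘ suc
    a  = v i * pf A′ J
    ih = pf-expand A′ ((λ i j → anti (suc i) (suc j)) , diag ∘ suc) i

  pf-wick : (A : Fin n → Fin n → Carrier) → Skew A → ∀ J K → wick (pf A) (pf A) J K ≈ 0#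
  pf-wick A skew@(anti , _) J K = begin
    wick (pf A) (pf A) J K
      ≈⟨ wick-wedge (pf A) (pf A) J K ⟩
    wedge (λ i → interior i (pf A) K) (pf A) J + wedge (λ i → interior i (pf A) J) (pf A) K
      ≈⟨ +-cong (wedge-congᶜ (pf A) J (λ i → pf-expand A skew i K)) (wedge-congᶜ (pf A) K (λ i → pf-expand A skew i J)) ⟨
    wedge (λ i → wedge (A i) (pf A) K) (pf A) J + wedge (λ i → wedge (A i) (pf A) J) (pf A) K
      -- Exchanging the order of summation transposes `A` in the second double sum, so skewness
      -- makes it the negative of the first.
      ≈⟨ +-congˡ (wedge-swap A (pf A) (pf A) K J) ⟩
    s + wedge (λ j → wedge (flip A j) (pf A) K) (pf A) J
      ≈⟨ +-congˡ (wedge-congᶜ (pf A) J (λ j → ≈-trans (wedge-congᶜ (pf A) K (λ i → anti j i)) (wedge-negᶜ (A j) (pf A) K))) ⟩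
    s + wedge (λ j → - wedge (A j) (pf A) K) (pf A) J
      ≈⟨ +-congˡ (wedge-negᶜ _ (pf A) J) ⟩
    s - s
      ≈⟨ -‿inverseʳ s ⟩
    0# ∎
    where s = wedge (λ i → wedge (A i) (pf A) K) (pf A) J

  -- `pf` makes no parity test of its own: each first-row expansion removes two elements and so
  -- keeps the parity, and a singleton has an empty expansion.
  pf-odd : ∀ n (A : Fin n → Fin n → Carrier) J → even ∣ J ∣ ≡ false → pf A J ≈ 0#
  pf-odd (suc n) A (false ∷ J) odd = pf-odd n _ J odd
  pf-odd (suc n) A (true ∷ J)  odd = wedge-0 _ {pf (λ i j → A (suc i) (suc j))} J λ i i∈J → pf-odd n _ (flipAt J i)
    (≡.trans (≡.sym (not-involutive _)) (≡.trans (cong (not ∘ even) (≡.sym (∣delete∣ i∈J))) odd))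

  pf-⊥ : ∀ n (A : Fin n → Fin n → Carrier) → pf A ⊥ ≈ 1#
  pf-⊥ zero    A = ≈-refl
  pf-⊥ (suc n) A = pf-⊥ n _

  -- The skew matrix with entry `q {i , j}` for `i < j`. Recursion on both indices takes the place
  -- of comparing them and matches the recursion of `pf`.
  pairMatrix : (Subset n → Carrier) → Fin n → Fin n → Carrier
  pairMatrix q zero    zero    = 0#
  pairMatrix q zero    (suc j) = q (true ∷ flipAt ⊥ j)
  pairMatrix q (suc i) zero    = - q (true ∷ flipAt ⊥ i)
  pairMatrix q (suc i) (suc j) = pairMatrix (q ∘ (false ∷_)) i j

  pairMatrix-skew : (q : Subset n → Carrier) → Skew (pairMatrix q)
  pairMatrix-skew q = anti q , diag q
    where
    anti : (q : Subset n → Carrier) → ∀ i j → pairMatrix q j i ≈ - pairMatrix q i j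
    anti q zero    zero    = ≈-sym -0#≈0#
    anti q zero    (suc j) = ≈-refl
    anti q (suc i) zero    = ≈-sym (-‿involutive _)
    anti q (suc i) (suc j) = anti (q ∘ (false ∷_)) i j
    diag : (q : Subset n → Carrier) → ∀ i → pairMatrix q i i ≈ 0#
    diag q zero    = ≈-refl
    diag q (suc i) = diag (q ∘ (false ∷_)) i

  pairMatrix-all : ∀ {r} (Q : Carrier → Set r) → Q 0# → (∀ {x} → Q x → Q (- x)) →
                   (q : Subset n → Carrier) → (∀ J → Q (q J)) → ∀ i j → Q (pairMatrix q i j)
  pairMatrix-all Q Q0 Q- q Qq zero    zero    = Q0
  pairMatrix-all Q Q0 Q- q Qq zero    (suc j) = Qq _
  pairMatrix-all Q Q0 Q- q Qq (suc i) zero    = Q- (Qq _)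
  pairMatrix-all Q Q0 Q- q Qq (suc i) (suc j) = pairMatrix-all Q Q0 Q- (q ∘ (false ∷_)) (Qq ∘ (false ∷_)) i j

  -- For the only element `i` of `J`, `flipAt ⊥ i` is `J` and `flipAt J i` is `⊥`.
  altSum-singleton : (J : Subset n) → ∣ J ∣ ≡ 1 → (t h : Subset n → Carrier) →
                     altSum J (λ i → t (flipAt ⊥ i) * h (flipAt J i)) ≈ t J * h ⊥
  altSum-singleton (false ∷ J) eq t h = altSum-singleton J eq (t ∘ (false ∷_)) (h ∘ (false ∷_))
  altSum-singleton (true ∷ J)  eq t h rewrite ∣J∣≡0⇒J≡⊥ J (ℕ.suc-injective eq) =
    ≈-trans (+-congˡ (-‿cong (altSum-0 ⊥ {λ i → t (false ∷ flipAt ⊥ i) * h (true ∷ flipAt ⊥ i)} (λ i i∈⊥ → contradiction i∈⊥ ∉⊥)))) (x-0≈x _)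

  pf-pairMatrix : (q : Subset n → Carrier) (J : Subset n) → ∣ J ∣ ≡ 2 → pf (pairMatrix q) J ≈ q J
  pf-pairMatrix q (false ∷ J) eq = pf-pairMatrix (q ∘ (false ∷_)) J eq
  pf-pairMatrix q (true ∷ J)  eq = begin
    altSum J (λ i → q (true ∷ flipAt ⊥ i) * pf A′ (flipAt J i))
      ≈⟨ altSum-singleton J (ℕ.suc-injective eq) (q ∘ (true ∷_)) (pf A′) ⟩
    q (true ∷ J) * pf A′ ⊥ ≈⟨ *-congˡ (pf-⊥ _ A′) ⟩
    q (true ∷ J) * 1#      ≈⟨ *-identityʳ _ ⟩
    q (true ∷ J)           ∎
    where A′ = pairMatrix (q ∘ (false ∷_))

  -- Translating both sets by `T` leaves `J Δ K`, and with it every sign, unchanged; each product of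
  -- two coordinates absorbs `u * u`.
  wick-rescale : (p f : Subset n → Carrier) {u : Carrier} (T : Subset n) →
                 (∀ J → u * p J ≈ f (J Δ T)) →
                 ∀ J K → (u * u) * wick p p J K ≈ wick f f (J Δ T) (K Δ T)
  wick-rescale p f {u} T eq J K = begin
    (u * u) * wick p p J K
      ≈⟨ altSum-*ˡ (J Δ K) (u * u) _ ⟨
    altSum (J Δ K) (λ i → (u * u) * (p (flipAt J i) * p (flipAt K i)))
      ≈⟨ altSum-cong (J Δ K) (λ i _ → ≈-trans (*-interchange u u _ _) (*-cong (eq′ J i) (eq′ K i))) ⟩
    altSum (J Δ K) (λ i → f (flipAt (J Δ T) i) * f (flipAt (K Δ T) i))
      ≈⟨ reflexive (cong (λ S → altSum S (λ i → f (flipAt (J Δ T) i) * f (flipAt (K Δ T) i))) (≡.sym (Δ-translate J K T))) ⟩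
    wick f f (J Δ T) (K Δ T) ∎
    where
    eq′ : ∀ L i → u * p (flipAt L i) ≈ f (flipAt (L Δ T) i)
    eq′ L i = ≈-trans (eq (flipAt L i)) (reflexive (cong f (flipAt-Δˡ L T i)))

-- Agreement with the list-based Wick sums and Pfaffians.

module _ {c ℓ g} (P : PartialField c ℓ g) where
  open PartialField P hiding (refl; sym; trans; zero)
  open PartialField P using () renaming (refl to ≈-refl; sym to ≈-sym; trans to ≈-trans)
  open RingProperties ring
  open import Relation.Binary.Reasoning.Setoid setoid

  -- The auxiliary functions of Defs are private, so the bodies left to unification below name
  -- them: each refl has a solution only after the arguments have been abstracted to variables.
  private
    mutual
      wickFrom : (Subset n → Carrier) → Subset n → Subset n → ℕ → List (Fin n) → Carrier
      wickFrom p J K k is = _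

      wickSum≡wickFrom : (p : Subset n → Carrier) (J K : Subset n) →
                         wickSum P p J K ≡ wickFrom p J K 1 (elems (J Δ K))
      wickSum≡wickFrom p J K with elems (J Δ K) | 1
      ... | is | k = refl

    -- Abstracting not itself exposes the parity test as an arbitrary test b of a counter.
    mutual
      pfWhen : (Fin n → Fin n → Carrier) → List (Fin n) → (Bool → Bool) → ℕ → Carrier
      pfWhen A is b m = _

      PfList≡pfWhen : (A : Fin n → Fin n → Carrier) (i : Fin n) (is : List (Fin n)) →
                      PfList P A (i ∷ is) ≡ pfWhen A (i ∷ is) not (length is)
      PfList≡pfWhen A i is with i ∷ is | not | length is
      ... | js | b | m = refl

    mutual
      pfFuel : (Fin n → Fin n → Carrier) → ℕ → List (Fin n) → Carrier
      pfFuel A f is = _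

      -- With `id` and `0` the parity test reduces to `true`, which exposes the fuelled recursion.
      pfWhen-true : (A : Fin n → Fin n → Carrier) (is : List (Fin n)) →
                    pfWhen A is id 0 ≡ pfFuel A (length is) is
      pfWhen-true A is with length is
      ... | f = refl

    mutual
      pfRow : (Fin n → Fin n → Carrier) → ℕ → Fin n → List (Fin n) → ℕ → List (Fin n) → Carrier
      pfRow A f i js k is = _

      removeAt : ℕ → List (Fin n) → List (Fin n)
      removeAt k is = _

      -- Splitting off the term of `j` makes the list from which elements are removed differ from
      -- the list still to be enumerated, so `pfRow` can take them as independent arguments.
      pfFuel-∷∷ : (A : Fin n → Fin n → Carrier) (f : ℕ) (i j : Fin n) (is : List (Fin n)) →
                  pfFuel A (suc f) (i ∷ j ∷ is) ≡ - (- 1#) * (A i j * pfFuel A f is) + pfRow A f i (j ∷ is) 2 is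
      pfFuel-∷∷ A f i j is with j ∷ is | 2
      ... | js | k = refl

      pfRow-∷ : (A : Fin n → Fin n → Carrier) (f : ℕ) (i : Fin n) (js : List (Fin n)) (k : ℕ) (j : Fin n) (is : List (Fin n)) →
                pfRow A f i js k (j ∷ is) ≡ sgn P (suc k) * (A i j * pfFuel A f (removeAt k js)) + pfRow A f i js (suc k) is
      pfRow-∷ A f i js k j is = refl

    -- Each successor moves one `not` from the counter into `b`, so the claim is proved for all `b`
    -- at once.
    pfWhen-even : (A : Fin n → Fin n → Carrier) (is : List (Fin n)) (b : Bool → Bool) (m : ℕ) →
                  pfWhen A is b m ≡ (if b (even m) then pfFuel A (length is) is else 0#)
    pfWhen-even A is b (suc m) = pfWhen-even A is (b ∘ not) m
    pfWhen-even A is b zero with b true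
    ... | true  = refl
    ... | false = refl

    PfList≡ : (A : Fin n → Fin n → Carrier) (is : List (Fin n)) →
              PfList P A is ≡ (if even (length is) then pfFuel A (length is) is else 0#)
    PfList≡ A []       = refl
    PfList≡ A (i ∷ is) = ≡.trans (PfList≡pfWhen A i is) (pfWhen-even A (i ∷ is) not (length is))

    removeAt-++ : (is : List (Fin n)) (j : Fin n) (js : List (Fin n)) →
                  removeAt (suc (length is)) (is ++ j ∷ js) ≡ is ++ js
    removeAt-++ []       j js = refl
    removeAt-++ (i ∷ is) j js = cong (i ∷_) (removeAt-++ is j js)

    sgn-suc : ∀ k a b → sgn P k * a + sgn P (suc k) * b ≈ sgn P k * (a - b)
    sgn-suc k a b = ≈-trans (+-congˡ (≈-sym (-‿distribˡ-* _ b))) (≈-sym (x[y-z]≈xy-xz _ a b))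

    sgn-suc² : ∀ k a b → sgn P (suc (suc k)) * a + sgn P (suc k) * b ≈ sgn P k * (a - b)
    sgn-suc² k a b = ≈-trans (+-congʳ (*-congʳ (-‿involutive _))) (sgn-suc k a b)

    -- `ρ` embeds the tail of the index set into the original one during the recursion on `S`, while
    -- the counter `k` carries the sign.
    wickFrom-altSum : ∀ {m} (p : Subset n → Carrier) (J K : Subset n) (k : ℕ) (S : Subset m) (ρ : Fin m → Fin n) →
                      wickFrom p J K k (List.map ρ (elems S)) ≈
                      sgn P k * altSum R S (λ i → p (flipAt J (ρ i)) * p (flipAt K (ρ i)))
    wickFrom-altSum p J K k []          ρ = ≈-sym (zeroʳ _)
    wickFrom-altSum p J K k (false ∷ S) ρ =
      ≈-trans (reflexive (cong (wickFrom p J K k) (≡.sym (List.map-∘ (elems S)))))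
              (wickFrom-altSum p J K k S (ρ ∘ suc))
    wickFrom-altSum p J K k (true ∷ S)  ρ =
      ≈-trans (+-congˡ (≈-trans (reflexive (cong (wickFrom p J K (suc k)) (≡.sym (List.map-∘ (elems S)))))
                                (wickFrom-altSum p J K (suc k) S (ρ ∘ suc))))
              (sgn-suc k _ _)

    -- `is` holds the columns already passed and `js` the whole row. Positions count from 1, so the
    -- next column has position `suc (length is)` and sign exponent `length is + 2`.
    pfRow-altSum : ∀ {m} (A : Fin n → Fin n → Carrier) (f : ℕ) (i : Fin n) (js is : List (Fin n)) (S : Subset m) (ρ : Fin m → Fin n) →
                   is ++ List.map ρ (elems S) ≡ js →
                   pfRow A f i js (suc (length is)) (List.map ρ (elems S)) ≈
                   sgn P (length is) * altSum R S (λ j → A i (ρ j) * pfFuel A f (is ++ List.map ρ (elems (flipAt S j))))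
    pfRow-altSum A f i _ is []          ρ refl = ≈-sym (zeroʳ _)
    pfRow-altSum A f i js is (false ∷ S) ρ eq   = begin
      pfRow A f i js (suc (length is)) (List.map ρ (List.map suc (elems S)))
        ≈⟨ reflexive (cong (pfRow A f i js (suc (length is))) (≡.sym (List.map-∘ (elems S)))) ⟩
      pfRow A f i js (suc (length is)) (List.map (ρ ∘ suc) (elems S))
        ≈⟨ pfRow-altSum A f i js is S (ρ ∘ suc) (≡.trans (cong (is ++_) (List.map-∘ (elems S))) eq) ⟩
      sgn P (length is) * altSum R S (λ j → A i (ρ (suc j)) * pfFuel A f (is ++ List.map (ρ ∘ suc) (elems (flipAt S j))))
        ≈⟨ *-congˡ (altSum-cong R S λ j _ → *-congˡ (reflexive (cong (λ L → pfFuel A f (is ++ L)) (List.map-∘ (elems (flipAt S j)))))) ⟩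
      sgn P (length is) * altSum R S (λ j → A i (ρ (suc j)) * pfFuel A f (is ++ List.map ρ (List.map suc (elems (flipAt S j))))) ∎
    pfRow-altSum A f i js is (true ∷ S)  ρ eq   = begin
      sgn P (suc (suc (length is))) * (A i (ρ zero) * pfFuel A f (removeAt (suc (length is)) js))
        + pfRow A f i js (suc (suc (length is))) L
        ≈⟨ +-cong (*-congˡ (*-congˡ (reflexive (cong (pfFuel A f) removed))))
                 (reflexive (cong₂ (pfRow A f i js) (cong suc (≡.sym len)) L≡)) ⟩
      sgn P (suc (suc (length is))) * (A i (ρ zero) * pfFuel A f (is ++ L))
        + pfRow A f i js (suc (length is′)) (List.map (ρ ∘ suc) (elems S))
        ≈⟨ +-congˡ (pfRow-altSum A f i js is′ S (ρ ∘ suc) (≡.trans (≡.trans (cong (is′ ++_) (≡.sym L≡)) (List.++-assoc is _ L)) eq)) ⟩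
      sgn P (suc (suc (length is))) * (A i (ρ zero) * pfFuel A f (is ++ L))
        + sgn P (length is′) * altSum R S (λ j → A i (ρ (suc j)) * pfFuel A f (is′ ++ List.map (ρ ∘ suc) (elems (flipAt S j))))
        ≈⟨ +-congˡ (*-cong (reflexive (cong (sgn P) len))
                          (altSum-cong R S λ j _ → *-congˡ (reflexive (cong (pfFuel A f) (relist j))))) ⟩
      sgn P (suc (suc (length is))) * (A i (ρ zero) * pfFuel A f (is ++ L))
        + sgn P (suc (length is)) * altSum R S (λ j → A i (ρ (suc j)) * pfFuel A f (is ++ List.map ρ (zero ∷ List.map suc (elems (flipAt S j)))))
        ≈⟨ sgn-suc² (length is) _ _ ⟩
      sgn P (length is) * altSum R (true ∷ S) (λ j → A i (ρ j) * pfFuel A f (is ++ List.map ρ (elems (flipAt (true ∷ S) j)))) ∎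
      where
      L = List.map ρ (List.map suc (elems S))
      is′ = is ++ ρ zero ∷ []
      L≡ : L ≡ List.map (ρ ∘ suc) (elems S)
      L≡ = ≡.sym (List.map-∘ (elems S))
      len : length is′ ≡ suc (length is)
      len = ≡.trans (List.length-++ is) (ℕ.+-comm (length is) 1)
      removed : removeAt (suc (length is)) js ≡ is ++ L
      removed = ≡.trans (cong (removeAt (suc (length is))) (≡.sym eq)) (removeAt-++ is (ρ zero) L)
      relist : ∀ j →
               is′ ++ List.map (ρ ∘ suc) (elems (flipAt S j)) ≡ is ++ List.map ρ (zero ∷ List.map suc (elems (flipAt S j)))
      relist j = ≡.trans (List.++-assoc is _ _) (cong (λ M → is ++ ρ zero ∷ M) (List.map-∘ (elems (flipAt S j))))

    -- An expansion spends one unit of fuel and removes two elements, so the fuel stays at least the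
    -- size; the inequality allows for the growing surplus.
    pfFuel≈pf : ∀ m (A : Fin n → Fin n → Carrier) (ρ : Fin m → Fin n) (f : ℕ) (J : Subset m) → ∣ J ∣ ≤ f →
                pfFuel A f (List.map ρ (elems J)) ≈ pf R (λ i j → A (ρ i) (ρ j)) J
    pfFuel≈pf zero    A ρ zero    [] _ = ≈-refl
    pfFuel≈pf zero    A ρ (suc f) [] _ = ≈-refl
    pfFuel≈pf (suc m) A ρ f (false ∷ J) le =
      ≈-trans (reflexive (cong (pfFuel A f) (≡.sym (List.map-∘ (elems J))))) (pfFuel≈pf m A (ρ ∘ suc) f J le)
    pfFuel≈pf (suc m) A ρ (suc f) (true ∷ J) (s≤s le) = begin
      pfRow A f (ρ zero) L 1 L
        ≈⟨ reflexive (cong (pfRow A f (ρ zero) L 1) (≡.sym (List.map-∘ (elems J)))) ⟩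
      pfRow A f (ρ zero) L 1 (List.map (ρ ∘ suc) (elems J))
        ≈⟨ pfRow-altSum A f (ρ zero) L [] J (ρ ∘ suc) (List.map-∘ (elems J)) ⟩
      1# * altSum R J (λ j → A (ρ zero) (ρ (suc j)) * pfFuel A f (List.map (ρ ∘ suc) (elems (flipAt J j))))
        ≈⟨ *-identityˡ _ ⟩
      altSum R J (λ j → A (ρ zero) (ρ (suc j)) * pfFuel A f (List.map (ρ ∘ suc) (elems (flipAt J j))))
        ≈⟨ altSum-cong R J (λ j j∈J → *-congˡ (pfFuel≈pf m A (ρ ∘ suc) f (flipAt J j)
             (ℕ.≤-trans (ℕ.≤-trans (ℕ.n≤1+n _) (ℕ.≤-reflexive (≡.sym (∣delete∣ j∈J)))) le))) ⟩
      pf R (λ i j → A (ρ i) (ρ j)) (true ∷ J) ∎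
      where L = List.map ρ (List.map suc (elems J))

  wickSum≈-wick : (p : Subset n → Carrier) (J K : Subset n) → wickSum P p J K ≈ - wick R p p J K
  wickSum≈-wick p J K = begin
    wickSum P p J K                                      ≈⟨ reflexive (wickSum≡wickFrom p J K) ⟩
    wickFrom p J K 1 (elems (J Δ K))
      ≈⟨ reflexive (cong (wickFrom p J K 1) (≡.sym (List.map-id (elems (J Δ K))))) ⟩
    wickFrom p J K 1 (List.map id (elems (J Δ K)))       ≈⟨ wickFrom-altSum p J K 1 (J Δ K) id ⟩
    - 1# * wick R p p J K                                ≈⟨ -1*x≈-x _ ⟩
    - wick R p p J K                                     ∎

  PfSub≈pf : (A : Fin n → Fin n → Carrier) (J : Subset n) → PfSub P A J ≈ pf R A J
  PfSub≈pf A J = ≈-trans (reflexive (PfList≡ A (elems J))) (≈-trans (reflexive eq) (by-parity (even ∣ J ∣) refl))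
    where
    eq : (if even (length (elems J)) then pfFuel A (length (elems J)) (elems J) else 0#) ≡
         (if even ∣ J ∣ then pfFuel A ∣ J ∣ (List.map id (elems J)) else 0#)
    eq = cong₂ (λ k is → if even k then pfFuel A k is else 0#) (length-elems J) (≡.sym (List.map-id (elems J)))
    by-parity : ∀ b → even ∣ J ∣ ≡ b → (if b then pfFuel A ∣ J ∣ (List.map id (elems J)) else 0#) ≈ pf R A J
    by-parity true  _   = pfFuel≈pf _ A id ∣ J ∣ J ℕ.≤-refl
    by-parity false odd = ≈-sym (pf-odd R _ A J odd)

  -- Units and zeros in a partial field.

  G⇒*-cancelˡ : ∀ {x y z} → G x → x * y ≈ x * z → y ≈ z
  G⇒*-cancelˡ {x} {y} {z} Gx xy≈xz with G-unit Gx
  ... | x⁻¹ , xx⁻¹≈1 = ≈-trans (≈-sym (cancel y)) (≈-trans (*-congˡ xy≈xz) (cancel z))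
    where
    cancel : ∀ w → x⁻¹ * (x * w) ≈ w
    cancel w = begin
      x⁻¹ * (x * w)  ≈⟨ *-assoc x⁻¹ x w ⟨
      (x⁻¹ * x) * w  ≈⟨ *-congʳ (≈-trans (*-comm x⁻¹ x) xx⁻¹≈1) ⟩
      1# * w         ≈⟨ *-identityˡ w ⟩
      w              ∎

  G*x≈0⇒x≈0 : ∀ {x y} → G x → x * y ≈ 0# → y ≈ 0#
  G*x≈0⇒x≈0 {x} Gx xy≈0 = G⇒*-cancelˡ Gx (≈-trans xy≈0 (≈-sym (zeroʳ x)))

  -x≈0⇒x≈0 : ∀ {x} → - x ≈ 0# → x ≈ 0#
  -x≈0⇒x≈0 -x≈0 = -‿injective (≈-trans -x≈0 (≈-sym -0#≈0#))

  -- The zero ring is ruled out by the nonzero coordinate of a point.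
  ≉0⇒1≉0 : ∀ {x} → ¬ x ≈ 0# → ¬ 1# ≈ 0#
  ≉0⇒1≉0 {x} x≉0 1≈0 = x≉0 (≈-trans (≈-sym (*-identityˡ x)) (≈-trans (*-congʳ 1≈0) (zeroˡ x)))

  InP∧≉0⇒G : ∀ {x} → InP x → ¬ x ≈ 0# → G x
  InP∧≉0⇒G (inj₁ Gx)  _   = Gx
  InP∧≉0⇒G (inj₂ x≈0) x≉0 = contradiction x≈0 x≉0

  G⇒≉0 : ¬ 1# ≈ 0# → ∀ {x} → G x → ¬ x ≈ 0#
  G⇒≉0 1≉0 Gx x≈0 = 1≉0 (G*x≈0⇒x≈0 Gx (≈-trans (*-identityʳ _) x≈0))

  -- An element of the partial field comes marked as unit or zero, so its vanishing is decidable
  -- although equality in the ring need not be.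
  InP⇒≈0? : ¬ 1# ≈ 0# → ∀ {x} → InP x → Dec (x ≈ 0#)
  InP⇒≈0? 1≉0 (inj₁ Gx)  = no (G⇒≉0 1≉0 Gx)
  InP⇒≈0? 1≉0 (inj₂ x≈0) = yes x≈0

  InP-neg : ∀ {x} → InP x → InP (- x)
  InP-neg (inj₁ Gx)  = inj₁ (G-resp (-1*x≈-x _) (G-mul G-negOne Gx))
  InP-neg (inj₂ x≈0) = inj₂ (≈-trans (-‿cong x≈0) -0#≈0#)

  G-*-InP : ∀ {x y} → G x → InP y → InP (x * y)
  G-*-InP Gx (inj₁ Gy)      = inj₁ (G-mul Gx Gy)
  G-*-InP {x} Gx (inj₂ y≈0) = inj₂ (≈-trans (*-congˡ y≈0) (zeroʳ x))

  wickSum≈0⇒wick≈0 : (p : Subset n → Carrier) (J K : Subset n) → wickSum P p J K ≈ 0# → wick R p p J K ≈ 0#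
  wickSum≈0⇒wick≈0 p J K eq = -x≈0⇒x≈0 (≈-trans (≈-sym (wickSum≈-wick p J K)) eq)

  -- From Pfaffians to strong and on to weak orthogonal matroids.

  pfaffian⇒strong : (p : Subset n → Carrier) → IsPointRep P p → PfaffianRep P p → StrongOM P p
  pfaffian⇒strong p pt (A , (_ , skew) , T , u , Gu , eq) = pt , λ J K →
    ≈-trans (wickSum≈-wick p J K)
      (≈-trans (-‿cong (G*x≈0⇒x≈0 (G-mul Gu Gu)
        (≈-trans (wick-rescale R p (pf R A) T (λ L → ≈-trans (eq L) (PfSub≈pf A (L Δ T))) J K)
                 (pf-wick R A skew (J Δ T) (K Δ T)))))
        -0#≈0#)

  strong⇒weak : (p : Subset n → Carrier) → StrongOM P p → WeakOM P p
  strong⇒weak p (pt@(inP , B , pB≉0) , wick≈0) = pt , (λ J K _ → wick≈0 J K) , (B , pB≉0) , exchange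
    where
    1≉0 : ¬ 1# ≈ 0#
    1≉0 = ≉0⇒1≉0 pB≉0
    ≈0? : ∀ J → Dec (p J ≈ 0#)
    ≈0? J = InP⇒≈0? 1≉0 (inP J)
    exchange : ∀ B₁ B₂ → ¬ p B₁ ≈ 0# → ¬ p B₂ ≈ 0# → ∀ x₁ → x₁ ∈ (B₁ Δ B₂) →
               ∃[ x₂ ] (x₂ ∈ (B₁ Δ B₂) × ¬ (x₂ ≡ x₁) × ¬ p (flipAt (flipAt B₁ x₁) x₂) ≈ 0#)
    exchange B₁ B₂ p₁≉0 p₂≉0 x x∈
      with Fin.any? (λ y → (y ∈? (B₁ Δ B₂)) ×-dec ¬? (y Fin.≟ x) ×-dec ¬? (≈0? (flipAt (flipAt B₁ x) y)))
    ... | yes found = found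
    ... | no none   = contradiction p₁p₂≈0 (G⇒≉0 1≉0 (G-mul (InP∧≉0⇒G (inP B₁) p₁≉0) (InP∧≉0⇒G (inP B₂) p₂≉0)))
      where
      J = flipAt B₁ x
      K = flipAt B₂ x
      JΔK : J Δ K ≡ B₁ Δ B₂
      JΔK = ≡.trans (flipAt-Δˡ B₁ K x)
              (≡.trans (cong (λ L → flipAt L x) (flipAt-Δʳ B₁ B₂ x)) (flipAt-involutive _ x))
      others : ∀ y → y ∈ (J Δ K) → y ≢ x → p (flipAt J y) * p (flipAt K y) ≈ 0#
      others y y∈ y≢x = ≈-trans (*-congʳ (decidable-stable (≈0? _) λ ≉0 →
        none (y , subst (y ∈_) JΔK y∈ , y≢x , ≉0))) (zeroˡ _)
      p₁p₂≈0 : p B₁ * p B₂ ≈ 0#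
      p₁p₂≈0 = begin
        p B₁ * p B₂
          ≈⟨ reflexive (cong₂ (λ L M → p L * p M) (≡.sym (flipAt-involutive B₁ x)) (≡.sym (flipAt-involutive B₂ x))) ⟩
        p (flipAt J x) * p (flipAt K x)
          -- Comparison with a sum of zeros leaves only the term of `x`.
          ≈⟨ altSum-isolate R (J Δ K) {u = λ _ → 0#} (subst (x ∈_) (≡.sym JΔK) x∈) others
                                             (≈-trans (wickSum≈0⇒wick≈0 p J K (wick≈0 J K)) (≈-sym (altSum-0 R (J Δ K) (λ _ _ → ≈-refl)))) ⟩
        0#                            ∎

  -- Recovering a normalised vector from its values on pairs.

  module _ {n} (1≉0 : ¬ 1# ≈ 0#) (q : Subset n → Carrier) (inP : ∀ J → InP (q J)) (q⊥≈1 : q ⊥ ≈ 1#)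
    (four : ∀ J K → ∣ J Δ K ∣ ≡ 4 → wick R q q J K ≈ 0#)
    (descend : ∀ J → ¬ q J ≈ 0# → ∀ x → x ∈ J →
               ∃[ y ] (y ∈ J × ¬ (y ≡ x) × ¬ q (flipAt (flipAt J x) y) ≈ 0#))
    where
    private
      A = pairMatrix R q
      r = pf R A

    -- The 4-term relation is taken for `J` without `x` and `J` without `y`, `z`, `w`. Its term at
    -- `x` pairs `J` with the set `N` lacking all four; every other term involves only sets smaller
    -- than `J`, where `q` and `r` agree. As `r` satisfies the same relation, the terms at `x`
    -- agree, and the unit `q N` cancels.
    wick-determines : ∀ {J x y z w} → x ∈ J → y ∈ flipAt J x →
      z ∈ flipAt (flipAt J x) y → w ∈ flipAt (flipAt (flipAt J x) y) z →
      (∀ K → ∣ K ∣ < ∣ J ∣ → q K ≈ r K) →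
      ¬ q (flipAt (flipAt (flipAt (flipAt J x) y) z) w) ≈ 0# → q J ≈ r J
    wick-determines {J} {x} {y} {z} {w} x∈ y∈ z∈ w∈ ih q≉0 =
      G⇒*-cancelˡ (InP∧≉0⇒G (inP N) q≉0) (begin
        q N * q J                        ≈⟨ *-comm _ _ ⟩
        q J * q N
          ≈⟨ reflexive (cong₂ (λ L M → q L * q M) (≡.sym (flipAt-involutive J x)) (≡.sym Kx≡N)) ⟩
        q (flipAt H x) * q (flipAt K x)
          ≈⟨ altSum-isolate R (H Δ K) (subst (x ∈_) (≡.sym HΔK) (∉⇒∈flipAt x∉S₃)) others
                                              (≈-trans (four H K (≡.trans (cong ∣_∣ HΔK) ∣S∣≡4)) (≈-sym (pf-wick R A (pairMatrix-skew R q) H K))) ⟩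
        r (flipAt H x) * r (flipAt K x)  ≈⟨ reflexive (cong₂ (λ L M → r L * r M) (flipAt-involutive J x) Kx≡N) ⟩
        r J * r N                        ≈⟨ *-comm _ _ ⟩
        r N * r J                        ≈⟨ *-congʳ (ih N N<J) ⟨
        q N * r J                        ∎)
      where
      H  = flipAt J x
      L  = flipAt H y
      M  = flipAt L z
      N  = flipAt M w
      K₁ = flipAt J y
      K₂ = flipAt K₁ z
      K  = flipAt K₂ w
      S₁ = flipAt ⊥ y
      S₂ = flipAt S₁ z
      S₃ = flipAt S₂ w
      y∈′ = ∈-delete⁻ x∈ y∈
      z∈′ = ∈-delete⁻ y∈ z∈
      z∈″ = ∈-delete⁻ x∈ (proj₂ z∈′)
      w∈′ = ∈-delete⁻ z∈ w∈
      w∈″ = ∈-delete⁻ y∈ (proj₂ w∈′)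
      w∈‴ = ∈-delete⁻ x∈ (proj₂ w∈″)
      Kx≡N : flipAt K x ≡ N
      Kx≡N = ≡.trans (flipAt-comm K₂ w x) (cong (λ V → flipAt V w)
               (≡.trans (flipAt-comm K₁ z x) (cong (λ V → flipAt V z) (flipAt-comm J y x))))
      HΔK : H Δ K ≡ flipAt S₃ x
      HΔK = ≡.trans (flipAt-Δˡ J K x) (cong (λ V → flipAt V x)
              (≡.trans (flipAt-Δʳ J K₂ w) (cong (λ V → flipAt V w)
                (≡.trans (flipAt-Δʳ J K₁ z) (cong (λ V → flipAt V z)
                  (≡.trans (flipAt-Δʳ J J y) (cong (λ V → flipAt V y) (Δ-self J))))))))
      ∈S₁ : ∀ {i} → i ∈ S₁ → i ≡ y
      ∈S₁ i∈ with ∈-flipAt⁻ i∈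
      ... | inj₁ i≡y = i≡y
      ... | inj₂ i∈⊥ = contradiction i∈⊥ ∉⊥
      ∈S₂ : ∀ {i} → i ∈ S₂ → i ≡ z ⊎ i ≡ y
      ∈S₂ i∈ = [ inj₁ , inj₂ ∘ ∈S₁ ]′ (∈-flipAt⁻ i∈)
      ∈S₃ : ∀ {i} → i ∈ S₃ → i ≡ w ⊎ (i ≡ z ⊎ i ≡ y)
      ∈S₃ i∈ = [ inj₁ , inj₂ ∘ ∈S₂ ]′ (∈-flipAt⁻ i∈)
      x∉S₃ : x ∉ S₃
      x∉S₃ x∈S with ∈S₃ x∈S
      ... | inj₁ x≡w        = proj₁ w∈‴ (≡.sym x≡w)
      ... | inj₂ (inj₁ x≡z) = proj₁ z∈″ (≡.sym x≡z)
      ... | inj₂ (inj₂ x≡y) = proj₁ y∈′ (≡.sym x≡y)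
      ∣S∣≡4 : ∣ flipAt S₃ x ∣ ≡ 4
      ∣S∣≡4 = ≡.trans (∣adjoin∣ x∉S₃) (cong suc
        (≡.trans (∣adjoin∣ ([ proj₁ w∈′ , proj₁ w∈″ ]′ ∘ ∈S₂)) (cong suc
          (≡.trans (∣adjoin∣ (proj₁ z∈′ ∘ ∈S₁)) (cong suc
            (≡.trans (∣adjoin∣ (∉⊥ {x = y})) (cong suc (∣⊥∣≡0 n))))))))
      ∣J∣≡4+∣N∣ : ∣ J ∣ ≡ suc (suc (suc (suc ∣ N ∣)))
      ∣J∣≡4+∣N∣ = ≡.trans (∣delete∣ x∈) (cong suc (≡.trans (∣delete∣ y∈)
                   (cong suc (≡.trans (∣delete∣ z∈) (cong suc (∣delete∣ w∈))))))
      N<J : ∣ N ∣ < ∣ J ∣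
      N<J = ℕ.≤-trans (ℕ.m≤n+m _ 3) (ℕ.≤-reflexive (≡.sym ∣J∣≡4+∣N∣))
      ∣K∣ : ∣ K ∣ ≡ suc ∣ N ∣
      ∣K∣ = ≡.trans (∣delete∣ (∈-flipAt⁺ x≢w (∈-flipAt⁺ x≢z (∈-flipAt⁺ x≢y x∈)))) (cong (suc ∘ ∣_∣) Kx≡N)
        where
        x≢w = proj₁ w∈‴ ∘ ≡.sym
        x≢z = proj₁ z∈″ ∘ ≡.sym
        x≢y = proj₁ y∈′ ∘ ≡.sym
      H-small : ∀ {i} → i ∈ H → ∣ flipAt H i ∣ < ∣ J ∣
      H-small i∈H = ℕ.≤-trans (ℕ.≤-reflexive (≡.sym (∣delete∣ i∈H))) (ℕ.≤-trans (ℕ.n≤1+n _) (ℕ.≤-reflexive (≡.sym (∣delete∣ x∈))))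
      -- Here `K` has three elements fewer than `J`, so a flip adding one still stays below `J`.
      K-small : ∀ i → ∣ flipAt K i ∣ < ∣ J ∣
      K-small i = ℕ.≤-trans (s≤s (ℕ.≤-trans (∣flipAt∣≤ K i) (ℕ.≤-reflexive (cong suc ∣K∣))))
                    (ℕ.≤-trans (ℕ.n≤1+n _) (ℕ.≤-reflexive (≡.sym ∣J∣≡4+∣N∣)))
      S₃⊆H : ∀ {i} → i ∈ S₃ → i ∈ H
      S₃⊆H i∈ with ∈S₃ i∈
      ... | inj₁ refl        = proj₂ w∈″
      ... | inj₂ (inj₁ refl) = proj₂ z∈′
      ... | inj₂ (inj₂ refl) = y∈
      others : ∀ i → i ∈ (H Δ K) → i ≢ x →
               q (flipAt H i) * q (flipAt K i) ≈ r (flipAt H i) * r (flipAt K i)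
      others i i∈ i≢x with ∈-flipAt⁻ (subst (i ∈_) HΔK i∈)
      ... | inj₁ i≡x  = contradiction i≡x i≢x
      ... | inj₂ i∈S₃ = *-cong (ih _ (H-small (S₃⊆H i∈S₃))) (ih _ (K-small i))

    private
      q≈0? : ∀ J → Dec (q J ≈ 0#)
      q≈0? J = InP⇒≈0? 1≉0 (inP J)

    q≈pf : ∀ m J → ∣ J ∣ < m → q J ≈ r J
    q≈pf (suc m) J (s≤s J≤m) with nonempty? J
    ... | no empty = ≈-trans (reflexive (cong q J≡⊥)) (≈-trans q⊥≈1
                       (≈-sym (≈-trans (reflexive (cong r J≡⊥)) (pf-⊥ R _ A))))
      where
      J≡⊥ : J ≡ ⊥
      J≡⊥ = ∣J∣≡0⇒J≡⊥ J (ℕ.n≤0⇒n≡0 (ℕ.≮⇒≥ (empty ∘ ∣J∣>0⇒nonempty J)))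
    ... | yes (x , x∈)
      with Fin.any? (λ y → (y ∈? flipAt J x) ×-dec ¬? (q≈0? (flipAt (flipAt J x) y)))
    -- Singletons fall under this case, since the search for `y` then ranges over the empty set.
    ... | no none = ≈-trans qJ≈0 (≈-sym rJ≈0)
      where
      H = flipAt J x
      none′ : ∀ y → y ∈ H → q (flipAt H y) ≈ 0#
      none′ y y∈ = decidable-stable (q≈0? _) (λ ≉0 → none (y , y∈ , ≉0))
      qJ≈0 : q J ≈ 0#
      qJ≈0 = decidable-stable (q≈0? J) λ qJ≉0 →
        let (y , y∈ , y≢x , ≉0) = descend J qJ≉0 x x∈ in none (y , ∈-flipAt⁺ y≢x y∈ , ≉0)
      small : ∀ y → y ∈ H → ∣ flipAt H y ∣ < m
      small y y∈ = ℕ.≤-trans (ℕ.≤-trans (ℕ.n≤1+n _) (ℕ.≤-reflexive (≡.sym (≡.trans (∣delete∣ x∈) (cong suc (∣delete∣ y∈)))))) J≤m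
      rJ≈0 : r J ≈ 0#
      rJ≈0 = interior-delete-0 R r x∈ (≈-trans (≈-sym (pf-expand R A (pairMatrix-skew R q) x H))
        (wedge-0 R (A x) {r} H λ y y∈ → ≈-trans (≈-sym (q≈pf m (flipAt H y) (small y y∈))) (none′ y y∈)))
    ... | yes (y , y∈ , ≉0) with nonempty? (flipAt (flipAt J x) y)
    -- Here `J` is the pair of `x` and `y`, whose Pfaffian is an entry of `A`.
    ...   | no empty = ≈-sym (pf-pairMatrix R q J (≡.trans (∣delete∣ x∈) (cong suc (≡.trans (∣delete∣ y∈)
                         (cong suc (ℕ.n≤0⇒n≡0 (ℕ.≮⇒≥ (empty ∘ ∣J∣>0⇒nonempty _))))))))
    ...   | yes (z , z∈) =
      let (w , w∈ , w≢z , ≉0′) = descend _ ≉0 z z∈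
      in wick-determines x∈ y∈ z∈ (∈-flipAt⁺ w≢z w∈) (λ K K<J → q≈pf m K (ℕ.≤-trans K<J J≤m)) ≉0′

  -- From weak orthogonal matroids to Pfaffians.

  weak⇒pfaffian : (p : Subset n → Carrier) → WeakOM P p → PfaffianRep P p
  weak⇒pfaffian {n} p ((inP , T , pT≉0) , four , _ , exchange) with G-unit (InP∧≉0⇒G (inP T) pT≉0)
  ... | u , pTu≈1 = A , (pairMatrix-all R InP (inj₂ ≈-refl) InP-neg q inQ , pairMatrix-skew R q) , T , u , Gu , eq
    where
    Gu : G u
    Gu = G-inv (InP∧≉0⇒G (inP T) pT≉0) pTu≈1
    q : Subset n → Carrier
    q J = u * p (J Δ T)
    A = pairMatrix R q
    inQ : ∀ J → InP (q J)
    inQ J = G-*-InP Gu (inP (J Δ T))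
    up≈q : ∀ J → u * p J ≈ q (J Δ T)
    up≈q J = *-congˡ (reflexive (cong p (≡.sym (Δ-cancelʳ J T))))
    q⊥≈1 : q ⊥ ≈ 1#
    q⊥≈1 = ≈-trans (*-congˡ (reflexive (cong p (⊥Δ T)))) (≈-trans (*-comm u (p T)) pTu≈1)
      where
      ⊥Δ : ∀ {n} (T : Subset n) → ⊥ Δ T ≡ T
      ⊥Δ []      = refl
      ⊥Δ (t ∷ T) = cong (t ∷_) (⊥Δ T)
    fourQ : ∀ J K → ∣ J Δ K ∣ ≡ 4 → wick R q q J K ≈ 0#
    fourQ J K ∣JΔK∣≡4 = begin
      wick R q q J K
        ≈⟨ reflexive (cong₂ (wick R q q) (≡.sym (Δ-cancelʳ J T)) (≡.sym (Δ-cancelʳ K T))) ⟩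
      wick R q q ((J Δ T) Δ T) ((K Δ T) Δ T)
        ≈⟨ wick-rescale R p q T up≈q (J Δ T) (K Δ T) ⟨
      (u * u) * wick R p p (J Δ T) (K Δ T)
        ≈⟨ *-congˡ (wickSum≈0⇒wick≈0 p (J Δ T) (K Δ T) (four (J Δ T) (K Δ T) size)) ⟩
      (u * u) * 0#
        ≈⟨ zeroʳ _ ⟩
      0# ∎
      where
      size : length (elems ((J Δ T) Δ (K Δ T))) ≡ 4
      size = ≡.trans (length-elems ((J Δ T) Δ (K Δ T))) (≡.trans (cong ∣_∣ (Δ-translate J K T)) ∣JΔK∣≡4)
    descend : ∀ J → ¬ q J ≈ 0# → ∀ x → x ∈ J →
              ∃[ y ] (y ∈ J × ¬ (y ≡ x) × ¬ q (flipAt (flipAt J x) y) ≈ 0#)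
    -- Exchange is applied to the bases `J Δ T` and `T`: their symmetric difference is `J`, so the
    -- element found lies in `J`.
    descend J qJ≉0 x x∈
      with exchange (J Δ T) T (λ p≈0 → qJ≉0 (≈-trans (*-congˡ p≈0) (zeroʳ u))) pT≉0 x
             (subst (x ∈_) (≡.sym (Δ-cancelʳ J T)) x∈)
    ... | y , y∈ , y≢x , p≉0 = y , subst (y ∈_) (Δ-cancelʳ J T) y∈ , y≢x ,
      λ q≈0 → p≉0 (≈-trans (reflexive (cong p (≡.sym (flipAt²-Δ J T x y)))) (G*x≈0⇒x≈0 Gu q≈0))
    eq : ∀ J → u * p J ≈ PfSub P A (J Δ T)
    eq J = ≈-trans (up≈q J) (≈-trans (q≈pf (≉0⇒1≉0 pT≉0) q inQ q⊥≈1 fourQ descend _ (J Δ T) ℕ.≤-refl)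
                                     (≈-sym (PfSub≈pf A (J Δ T))))

theorem4p3 : ∀ {c ℓ g} (P : PartialField c ℓ g) (n : ℕ)
    (p : Subset n → PartialField.Carrier P) → IsPointRep P p →
    (PfaffianRep P p ⇔ StrongOM P p) × (StrongOM P p ⇔ WeakOM P p)
theorem4p3 P n p pt =
  -- The converse directions are obtained by going round the cycle of three implications.
  mk⇔ (pfaffian⇒strong P p pt) (weak⇒pfaffian P p ∘ strong⇒weak P p) ,
  mk⇔ (strong⇒weak P p) (pfaffian⇒strong P p pt ∘ weak⇒pfaffian P p)
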